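{- Let $k\ge 2$ be even and $n>k/2$. Any encoding that, given access to encodings of both rows of a $2\times n$ array $A$ answering unsorted (or sorted) 1-sided Top-$k$ queries on each row, answers all unsorted 3-sided Top-$k$ queries on $A$ must use at least $\lceil (n-k/2)\lg(1+\sqrt2)\rceil-o(n)\approx 1.27(n-k/2)-o(n)$ additional bits (in the worst case over arrays $A$). Equivalently, there is a family of $2\times n$ arrays with distinct entries, all of whose rows give identical answers to every 1-sided Top-$k$ query on that row, containing at least $2^{(n-k/2)\lg(1+\sqrt2)-o(n)}$ arrays with pairwise distinct answer sets to the unsorted 3-sided Top-$k$ queries.
   Context: All arrays have pairwise distinct entries from a totally ordered set. For a 1D array $B[1..n]$, the 1-sided query Top-$k(1,i,B)$ returns the positions of the $k$ largest values of $B[1..i]$ (all positions if $i\le k$); sorted queries report these positions in decreasing order of value, unsorted queries in arbitrary order. For a $2\times n$ array $A$, a 3-sided Top-$k$ query Top-$k(r,s,1,b,A)$ with $1\le r\le s\le 2$, $1\le b\le n$ returns the positions of the $k$ largest values in $A[r..s][1..b]$ (rows $r..s$, columns $1..b$). "Additional bits" means the length of the bit string that, together with the given row encodings, determines all answers. -}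

module Defs where

open import Level using (Level; Lift; _⊔_)
open import Data.Bool.Base using (Bool)
open import Data.Fin.Base using (Fin; zero; suc) renaming (_≤_ to _≤ᶠ_)
open import Data.Fin.Properties using () renaming (_≤?_ to _≤ᶠ?_)
open import Data.List.Base using (List; length; filter; allFin; cartesianProduct)
open import Data.List.Membership.Propositional using (_∈_; _∉_)
open import Data.List.Relation.Unary.AllPairs using (AllPairs)
open import Data.List.Relation.Unary.Unique.Propositional using (Unique)
open import Data.Nat.Base using (ℕ; zero; suc; _+_; _*_; _∸_; _^_; _⊓_; _≤_)
open import Data.Product.Base using (_×_; _,_; ∃-syntax; Σ-syntax; proj₂)
open import Data.Unit.Base using (⊤)
open import Function.Bundles using (_⇔_)
open import Function.Definitions using (Injective)
open import Relation.Binary.Bundles using (StrictTotalOrder)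
open import Relation.Binary.PropositionalEquality.Core using (_≡_; cong)
open import Relation.Nullary.Negation.Core using (¬_)
open import Relation.Nullary.Decidable using (_×-dec_)

Bits : Set
Bits = List Bool

-- e(n) = o(n): for every q, eventually e(n) ≤ n / q.
LittleO : (ℕ → ℕ) → Set
LittleO e = ∀ q → ∃[ N ] (∀ n → N ≤ n → q * e n ≤ n)

-- rat + irr √2 with natural coefficients.
record ℕ[√2] : Set where
  constructor _+√2·_
  field
    rat irr : ℕ

1+√2 : ℕ[√2]
1+√2 = 1 +√2· 1

_*√_ : ℕ[√2] → ℕ[√2] → ℕ[√2]
(a +√2· b) *√ (c +√2· d) = (a * c + 2 * (b * d)) +√2· (a * d + b * c)

_^√_ : ℕ[√2] → ℕ → ℕ[√2]
x ^√ zero  = 1 +√2· 0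
x ^√ suc m = x *√ (x ^√ m)

-- The real order: a + b√2 ≤ c iff 0 ≤ c - a and (b√2)² ≤ (c - a)².
_≤√_ : ℕ[√2] → ℕ → Set
(a +√2· b) ≤√ c = a ≤ c × 2 * (b * b) ≤ (c ∸ a) * (c ∸ a)

-- lg x ≤ c; since m · lg x = lg (x ^ m), this also compares m · lg x with c.
lg_≤_ : ℕ[√2] → ℕ → Set
lg x ≤ c = x ≤√ (2 ^ c)

-- c = ⌈lg x⌉; minimising over ℕ is enough because every x used is at least 1.
_≡⌈lg_⌉ : ℕ → ℕ[√2] → Set
c ≡⌈lg x ⌉ = (lg x ≤ c) × (∀ c′ → lg x ≤ c′ → c ≤ c′)

-- lg (1 + √2) ≈ 1.27 in the sense 253/200 = 1.265 < lg (1 + √2) ≤ 1.275 = 51/40.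
lg[1+√2]≈1·27 : Set
lg[1+√2]≈1·27 = ¬ (lg (1+√2 ^√ 200) ≤ 253) × (lg (1+√2 ^√ 40) ≤ 51)

-- Whether the reported positions must come in decreasing order of value.
data Kind : Set where
  sorted unsorted : Kind

-- Row and column indices start at 0, so the index i : Fin n is column i + 1
-- and `prefix i` is the range of columns 1 .. i + 1.
prefix : ∀ {n} → Fin n → List (Fin n)
prefix {n} i = filter (_≤ᶠ? i) (allFin n)

record ThreeSidedQuery (n : ℕ) : Set where
  field
    r s : Fin 2
    r≤s : r ≤ᶠ s
    b   : Fin n

region : ∀ {n} → ThreeSidedQuery n → List (Fin 2 × Fin n)
region q = cartesianProduct (filter (λ x → (r ≤ᶠ? x) ×-dec (x ≤ᶠ? s)) (allFin 2)) (prefix b)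
  where open ThreeSidedQuery q

module _ {c ℓ₁ ℓ₂ : Level} (O : StrictTotalOrder c ℓ₁ ℓ₂) where

  open StrictTotalOrder O using (Carrier; _≈_; _<_)

  record Array (P : Set) : Set (c ⊔ ℓ₁) where
    field
      entry    : P → Carrier
      distinct : Injective _≡_ _≈_ entry

  open Array

  Array₁ Array₂ : ℕ → Set (c ⊔ ℓ₁)
  Array₁ n = Array (Fin n)
  Array₂ n = Array (Fin 2 × Fin n)

  row : ∀ {n} → Fin 2 → Array₂ n → Array₁ n
  row r A .entry j    = entry A (r , j)
  row r A .distinct p = cong proj₂ (distinct A p)

  InOrder : ∀ {P} → Kind → Array P → List P → Set ℓ₂
  InOrder sorted   A xs = AllPairs (λ p q → entry A q < entry A p) xs
  InOrder unsorted A xs = Lift ℓ₂ ⊤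

  -- xs is a correct answer to the Top-k query on the given range of positions.
  -- For unsorted queries every ordering of the answer set is correct.
  record IsTopK {P : Set} (κ : Kind) (k : ℕ) (A : Array P) (range xs : List P) : Set ℓ₂ where
    field
      unique  : Unique xs
      within  : ∀ {p} → p ∈ xs → p ∈ range
      size    : length xs ≡ k ⊓ length range
      largest : ∀ {p q} → p ∈ xs → q ∈ range → q ∉ xs → entry A q < entry A p
      inOrder : InOrder κ A xs

  SameAnswers : {P Q : Set} → Kind → ℕ → (Q → List P) → Array P → Array P → Set ℓ₂
  SameAnswers κ k range A A′ =
    ∀ q xs → IsTopK κ k A (range q) xs ⇔ IsTopK κ k A′ (range q) xs

  -- An encoding of the answers to the 1-sided queries on a row. The field
  -- `onlyAnswers` says that it carries no further information about the row;
  -- otherwise it could store all the values, and no additional bits would be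
  -- needed.
  record RowEncoding (κ : Kind) (k n : ℕ) : Set (c ⊔ ℓ₁ ⊔ ℓ₂) where
    field
      encode      : Array₁ n → Bits
      decode      : Bits → Fin n → List (Fin n)
      correct     : ∀ B i → IsTopK κ k B (prefix i) (decode (encode B) i)
      onlyAnswers : ∀ B B′ → SameAnswers κ k prefix B B′ → encode B ≡ encode B′

  record ThreeSidedEncoding {κ k n} (E₁ E₂ : RowEncoding κ k n) : Set (c ⊔ ℓ₁ ⊔ ℓ₂) where
    open RowEncoding
    field
      additional : Array₂ n → Bits
      decode₂    : Bits → Bits → Bits → ThreeSidedQuery n → List (Fin 2 × Fin n)
      correct₂   : ∀ A q → IsTopK unsorted k A (region q)
                     (decode₂ (encode E₁ (row zero A)) (encode E₂ (row (suc zero) A)) (additional A) q)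

  -- In the worst case at least ⌈m lg (1 + √2)⌉ - err additional bits are used.
  EncodingBound : (k n m err : ℕ) → Set (c ⊔ ℓ₁ ⊔ ℓ₂)
  EncodingBound k n m err =
    Σ[ t ∈ ℕ ] (t ≡⌈lg (1+√2 ^√ m) ⌉ ×
      (∀ κ (E₁ E₂ : RowEncoding κ k n) (X : ThreeSidedEncoding E₁ E₂) →
        Σ[ A ∈ Array₂ n ] t ≤ length (ThreeSidedEncoding.additional X A) + err))

  -- The last conjunct is M ≥ 2 ^ (m lg (1 + √2) - err), cleared of the
  -- negative exponent.
  FamilyBound : (k n m err : ℕ) → Set (c ⊔ ℓ₁ ⊔ ℓ₂)
  FamilyBound k n m err =
    Σ[ M ∈ ℕ ] Σ[ F ∈ (Fin M → Array₂ n) ]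
      ((∀ (i j : Fin M) r κ → SameAnswers κ k prefix (row r (F i)) (row r (F j)))
      × (∀ (i j : Fin M) → ¬ i ≡ j → ¬ SameAnswers unsorted k (region {n}) (F i) (F j))
      × (1+√2 ^√ m) ≤√ (M * 2 ^ err))

{-# OPTIONS --safe #-}

-- Let h = k / 2 and m = n - h. Take both rows increasing, so that only the way
-- they interleave is free. The top k of the first h + t columns then omits 2t
-- entries, namely t + x of row 0 and t - x of row 1; as t grows by 1, x changes by
-- at most 1. Conversely every sequence x₀ = 0, x₁, ..., x_m in {-1, 0, 1} with steps
-- in {-1, 0, 1} comes from an interleaving, and different sequences have different
-- answers. The transfer matrix of these sequences has the eigenvalue 1 + √2: with
-- (1 + √2)^m = p + q√2 there are p of them with x_m = 0, and (1 + √2)^m ≤ 4p.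
-- Requiring x_m = 0 costs a constant factor, absorbed in the error term e(n) = 3,
-- and makes the first 2n ranks sufficient for the values.
module Submission where

open import Defs
open import Data.Bool.Base using (true; false)
open import Data.Empty using (⊥; ⊥-elim)
open import Data.Fin.Base as Fin using (Fin; zero; suc; toℕ; fromℕ<; cast)
open import Data.Fin.Patterns using (0F; 1F)
open import Data.Fin.Properties as Fin using ()
open import Data.List.Base
  using (List; []; _∷_; _++_; map; length; lookup; filter; take; upTo; applyUpTo; allFin; cartesianProduct)
open import Data.List.Membership.Propositional using (_∈_; _∉_)
open import Data.List.Membership.Propositional.Properties
  using ( ∈-map⁺; ∈-map⁻; ∈-++⁺ˡ; ∈-++⁺ʳ; ∈-++⁻; ∈-filter⁺; ∈-filter⁻; ∈-lookup; ∈-upTo⁺; ∈-upTo⁻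
        ; ∈-applyUpTo⁺; ∈-allFin; ∈-cartesianProduct⁻)
open import Data.List.Membership.Setoid.Properties using (index-injective)
open import Data.List.Properties
  using (length-++; length-map; length-upTo; length-applyUpTo; length-tabulate; length-take; take++drop≡id)
open import Data.List.Relation.Binary.Disjoint.Propositional using (Disjoint)
open import Data.List.Relation.Binary.Permutation.Propositional using (_↭_; ↭-sym; ↭⇒↭ₛ)
open import Data.List.Relation.Binary.Permutation.Propositional.Properties using (∈-resp-↭; ↭-length)
open import Data.List.Relation.Binary.Subset.Propositional using (_⊆_)
open import Data.List.Relation.Unary.All as All using ([])
open import Data.List.Relation.Unary.AllPairs as AllPairs using (AllPairs; []; _∷_)
open import Data.List.Relation.Unary.Any as Any using (here; there)
open import Data.List.Relation.Unary.Sorted.TotalOrder.Properties using (Sorted⇒AllPairs)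
open import Data.List.Relation.Unary.Unique.Propositional using (Unique)
open import Data.List.Relation.Unary.Unique.Propositional.Properties as Unique using ()
open import Data.Nat.Base
open import Data.Nat.DivMod using (_/_; m*n/n≡m)
open import Data.Nat.Divisibility using (_∣_; divides)
open import Data.Nat.Properties
open import Data.Nat.Tactic.RingSolver using (solve-∀)
open import Data.Product.Base using (_×_; _,_; proj₁; proj₂; ∃-syntax; Σ-syntax; uncurry)
open import Data.Product.Properties using (≡-dec)
open import Data.Sum.Base using (_⊎_; inj₁; inj₂)
open import Function.Base using (_∘_; id)
open import Function.Bundles using (mk⇔; Equivalence)
open import Level using (Level; lift)
open import Relation.Binary.Bundles using (StrictTotalOrder; DecTotalOrder)
open import Relation.Binary.Core using (Rel)
open import Relation.Binary.Definitions using (tri<; tri≈; tri>; DecidableEquality)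
open import Relation.Binary.PropositionalEquality hiding ([_])
open import Relation.Nullary using (¬_; Dec; yes; no; ¬?)
open import Relation.Nullary.Decidable using (_×-dec_; from-yes; from-no)
open import Relation.Unary using (Decidable)
import Data.List.Membership.DecPropositional as DecMembership
import Data.List.Relation.Binary.Permutation.Setoid.Properties as Permutation
import Data.List.Sort as Sort
import Relation.Binary.Construct.Flip.EqAndOrd as Flip
import Relation.Binary.Construct.On as On
import Relation.Binary.Properties.StrictTotalOrder as StrictTotalOrderProperties

-- Walks and the interleavings they encode

-- A sequence x ending in 0, started at v - 1 = 1 - u, where always u + v = 2.
data Walk : (u v m : ℕ) → Set where
  []   : Walk 1 1 0
  stay : ∀ {u v m} → Walk u v m → Walk u v (suc m)
  up   : ∀ {u v m} → Walk u (suc v) m → Walk (suc u) v (suc m)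
  down : ∀ {u v m} → Walk (suc u) v m → Walk u (suc v) (suc m)

-- The numbers u (row 1) and v (row 0) after t steps.
height : ∀ {u v m} → Walk u v m → ℕ → Fin 2 → ℕ
height {v = v} w zero    0F = v
height {u = u} w zero    1F = u
height []        (suc t) r  = 1
height (stay w)  (suc t) r  = height w t r
height (up w)    (suc t) r  = height w t r
height (down w)  (suc t) r  = height w t r

-- f r j is the time at which element j of row r is read; cons a f reads one
-- element of row a first.
cons : Fin 2 → (Fin 2 → ℕ → ℕ) → Fin 2 → ℕ → ℕ
cons 0F f 0F zero    = 0
cons 0F f 0F (suc j) = suc (f 0F j)
cons 0F f 1F j       = suc (f 1F j)
cons 1F f 0F j       = suc (f 0F j)
cons 1F f 1F zero    = 0
cons 1F f 1F (suc j) = suc (f 1F j)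

-- Each step reads two elements, so the steps settle the ranks in consecutive pairs. Once the walk
-- ends the rows alternate forever, which matches the default height 1 and gives every column a
-- rank.
rank : ∀ {u v m} → Walk u v m → Fin 2 → ℕ → ℕ
rank []       r j = toℕ r + j * 2
rank (stay w) = cons 0F (cons 1F (rank w))
rank (up w)   = cons 0F (cons 0F (rank w))
rank (down w) = cons 1F (cons 1F (rank w))

Increasing : (Fin 2 → ℕ → ℕ) → Set
Increasing f = ∀ r {i j} → i < j → f r i < f r j

RowsDisjoint : (Fin 2 → ℕ → ℕ) → Set
RowsDisjoint f = ∀ i j → f 0F i ≢ f 1F j

cons-increasing : ∀ a {f} → Increasing f → Increasing (cons a f)
cons-increasing 0F f↑ 0F {zero}  {suc j} i<j       = z<s
cons-increasing 0F f↑ 0F {suc i} {suc j} (s<s i<j) = s<s (f↑ 0F i<j)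
cons-increasing 0F f↑ 1F i<j                       = s<s (f↑ 1F i<j)
cons-increasing 1F f↑ 0F i<j                       = s<s (f↑ 0F i<j)
cons-increasing 1F f↑ 1F {zero}  {suc j} i<j       = z<s
cons-increasing 1F f↑ 1F {suc i} {suc j} (s<s i<j) = s<s (f↑ 1F i<j)

cons-disjoint : ∀ a {f} → RowsDisjoint f → RowsDisjoint (cons a f)
cons-disjoint 0F f# zero    j       = λ ()
cons-disjoint 0F f# (suc i) j       = λ eq → f# i j (suc-injective eq)
cons-disjoint 1F f# i       zero    = λ ()
cons-disjoint 1F f# i       (suc j) = λ eq → f# i j (suc-injective eq)

double≢suc-double : ∀ i j → i * 2 ≢ suc (j * 2)
double≢suc-double i j eq = even≢odd i j (trans (*-comm 2 i) (trans eq (cong suc (*-comm j 2))))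

rank-increasing : ∀ {u v m} (w : Walk u v m) → Increasing (rank w)
rank-increasing []       r i<j = +-monoʳ-< (toℕ r) (*-monoˡ-< 2 i<j)
rank-increasing (stay w) = cons-increasing 0F (cons-increasing 1F (rank-increasing w))
rank-increasing (up w)   = cons-increasing 0F (cons-increasing 0F (rank-increasing w))
rank-increasing (down w) = cons-increasing 1F (cons-increasing 1F (rank-increasing w))

rank-disjoint : ∀ {u v m} (w : Walk u v m) → RowsDisjoint (rank w)
rank-disjoint []       = double≢suc-double
rank-disjoint (stay w) = cons-disjoint 0F (cons-disjoint 1F (rank-disjoint w))
rank-disjoint (up w)   = cons-disjoint 0F (cons-disjoint 0F (rank-disjoint w))
rank-disjoint (down w) = cons-disjoint 1F (cons-disjoint 1F (rank-disjoint w))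

rank-reflects-< : ∀ {u v m} (w : Walk u v m) r {i j} → rank w r i < rank w r j → i < j
rank-reflects-< w r {i} {j} lt with <-cmp i j
... | tri< i<j _ _    = i<j
... | tri≈ _ refl _   = ⊥-elim (<-irrefl refl lt)
... | tri> _ _ j<i    = ⊥-elim (<-asym lt (rank-increasing w r j<i))

rank-injectiveʳ : ∀ {u v m} (w : Walk u v m) r {i j} → rank w r i ≡ rank w r j → i ≡ j
rank-injectiveʳ w r {i} {j} eq with <-cmp i j
... | tri< i<j _ _  = ⊥-elim (<⇒≢ (rank-increasing w r i<j) eq)
... | tri≈ _ i≡j _  = i≡j
... | tri> _ _ j<i  = ⊥-elim (<⇒≢ (rank-increasing w r j<i) (sym eq))

rank-injective : ∀ {u v m} (w : Walk u v m) {r s i j} →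
                 rank w r i ≡ rank w s j → r ≡ s × i ≡ j
rank-injective w {0F} {0F} eq = refl , rank-injectiveʳ w 0F eq
rank-injective w {0F} {1F} eq = ⊥-elim (rank-disjoint w _ _ eq)
rank-injective w {1F} {0F} eq = ⊥-elim (rank-disjoint w _ _ (sym eq))
rank-injective w {1F} {1F} eq = refl , rank-injectiveʳ w 1F eq

-- The first t + height w t r - height w 0 r elements of row r have rank below 2t.
late : ∀ {u v m} (w : Walk u v m) r t {j} → t * 2 ≤ rank w r j →
       t + height w t r ≤ j + height w 0 r
late w r zero le = m≤n+m _ _
late [] 0F (suc t) {j} le       = +-monoˡ-≤ 1 (*-cancelʳ-≤ (suc t) j 2 le)
late [] 1F (suc t) {j} (s≤s le) = +-monoˡ-≤ 1 (*-cancelʳ-< 2 t j le)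
late (stay w) 0F (suc t) {suc j} (s≤s (s≤s le)) = s≤s (late w 0F t le)
late (stay w) 1F (suc t) {zero}  (s≤s ())
late (stay w) 1F (suc t) {suc j} (s≤s (s≤s le)) = s≤s (late w 1F t le)
late (up {v = v} w) 0F (suc t) {suc zero} (s≤s ())
late (up {v = v} w) 0F (suc t) {suc (suc j)} (s≤s (s≤s le)) =
  s≤s (≤-trans (late w 0F t le) (≤-reflexive (+-suc j v)))
late (up {u = u} w) 1F (suc t) {j} (s≤s (s≤s le)) =
  ≤-trans (s≤s (late w 1F t le)) (≤-reflexive (sym (+-suc j u)))
late (down {v = v} w) 0F (suc t) {j} (s≤s (s≤s le)) =
  ≤-trans (s≤s (late w 0F t le)) (≤-reflexive (sym (+-suc j v)))
late (down {u = u} w) 1F (suc t) {suc zero} (s≤s ())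
late (down {u = u} w) 1F (suc t) {suc (suc j)} (s≤s (s≤s le)) =
  s≤s (≤-trans (late w 1F t le) (≤-reflexive (+-suc j u)))

height-end : ∀ {u v m} (w : Walk u v m) r {t} → m ≤ t → height w t r ≡ 1
height-end []       0F {zero}  z≤n      = refl
height-end []       1F {zero}  z≤n      = refl
height-end []       r  {suc t} z≤n      = refl
height-end (stay w) r  {suc t} (s≤s le) = height-end w r le
height-end (up w)   r  {suc t} (s≤s le) = height-end w r le
height-end (down w) r  {suc t} (s≤s le) = height-end w r le

-- A step moves one unit between `u` and `v` or none, and the end state is `1 + 1`.
width : ∀ {u v m} → Walk u v m → v + u ≡ 2
width []                     = refl
width (stay w)               = width w
width (up {u} {v} w)         = trans (+-suc v u) (width w)
width (down {u} {v} w)       = trans (sym (+-suc v u)) (width w)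

height-sum : ∀ {u v m} (w : Walk u v m) t → height w t 0F + height w t 1F ≡ 2
height-sum w        zero    = width w
height-sum []       (suc t) = refl
height-sum (stay w) (suc t) = height-sum w t
height-sum (up w)   (suc t) = height-sum w t
height-sum (down w) (suc t) = height-sum w t

-- If the first steps agree, the tails are compared. If they differ, the height of row 0 already
-- differs at time 1.
separate : ∀ {u v m} (w w′ : Walk u v m) →
           w ≡ w′ ⊎ ∃[ t ] (t ≤ m × height w t 0F ≢ height w′ t 0F)
separate []       []        = inj₁ refl
separate (stay w) (stay w′) with separate w w′
... | inj₁ refl          = inj₁ refl
... | inj₂ (t , le , ne) = inj₂ (suc t , s≤s le , ne)
separate (up w)   (up w′) with separate w w′
... | inj₁ refl          = inj₁ refl
... | inj₂ (t , le , ne) = inj₂ (suc t , s≤s le , ne)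
separate (down w) (down w′) with separate w w′
... | inj₁ refl          = inj₁ refl
... | inj₂ (t , le , ne) = inj₂ (suc t , s≤s le , ne)
separate (stay w) (up w′)   = inj₂ (1 , s≤s z≤n , λ ())
separate (stay w) (down w′) = inj₂ (1 , s≤s z≤n , λ ())
separate (up w)   (stay w′) = inj₂ (1 , s≤s z≤n , λ ())
separate (up w)   (down w′) = inj₂ (1 , s≤s z≤n , λ ())
separate (down w) (stay w′) = inj₂ (1 , s≤s z≤n , λ ())
separate (down w) (up w′)   = inj₂ (1 , s≤s z≤n , λ ())

-- Counting walks

-- Splitting off `ups` and `downs` confines the question whether such a step is possible: each list
-- is empty when there is no unit left to move.
walks : ∀ m u v → List (Walk u v m)
ups   : ∀ m u v → List (Walk u v (suc m))
downs : ∀ m u v → List (Walk u v (suc m))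
walks zero 1 1    = [] ∷ []
walks zero _ _    = []
walks (suc m) u v = map stay (walks m u v) ++ ups m u v ++ downs m u v
ups   m zero    v = []
ups   m (suc u) v = map up (walks m u (suc v))
downs m u zero    = []
downs m u (suc v) = map down (walks m (suc u) v)

-- (1 + √2)^m counts the walks of length m from the middle state (rat) and from
-- either end state (irr) to the middle one.
length-walks : ∀ m → let open ℕ[√2] (1+√2 ^√ m) in
               length (walks m 1 1) ≡ rat × length (walks m 2 0) ≡ irr × length (walks m 0 2) ≡ irr
length-walks zero    = refl , refl , refl
length-walks (suc m) with length-walks m
... | mid , low , high =
    trans (first-step 1 1)
      (trans (cong₂ _+_ mid (cong₂ _+_ (trans (length-map up (walks m 0 2)) high)
                                       (trans (length-map down (walks m 2 0)) low)))
             (eq₁ rat irr))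
  , trans (first-step 2 0)
      (trans (cong₂ _+_ low (cong (_+ 0) (trans (length-map up (walks m 1 1)) mid)))
             (eq₂ rat irr))
  , trans (first-step 0 2)
      (trans (cong₂ _+_ high (trans (length-map down (walks m 1 1)) mid))
             (eq₃ rat irr))
  where
  open ℕ[√2] (1+√2 ^√ m)
  first-step : ∀ u v → length (walks (suc m) u v) ≡
               length (walks m u v) + (length (ups m u v) + length (downs m u v))
  first-step u v = trans (length-++ (map stay (walks m u v)))
                         (cong₂ _+_ (length-map stay (walks m u v)) (length-++ (ups m u v)))
  eq₁ : ∀ p q → p + (q + q) ≡ 1 * p + 2 * (1 * q)
  eq₁ = solve-∀
  eq₂ : ∀ p q → q + (p + 0) ≡ 1 * q + 1 * p
  eq₂ = solve-∀
  eq₃ : ∀ p q → q + p ≡ 1 * q + 1 * p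
  eq₃ = solve-∀

walks-unique : ∀ m u v → Unique (walks m u v)
ups-unique   : ∀ m u v → Unique (ups m u v)
downs-unique : ∀ m u v → Unique (downs m u v)
walks-unique zero 0 v = []
walks-unique zero 1 0 = []
walks-unique zero 1 1 = [] ∷ []
walks-unique zero 1 (suc (suc v)) = []
walks-unique zero (suc (suc u)) v = []
walks-unique (suc m) u v =
  Unique.++⁺ (Unique.map⁺ (λ { refl → refl }) (walks-unique m u v))
    (Unique.++⁺ (ups-unique m u v) (downs-unique m u v) (up#down u v)) (stay#rest u v)
  where
  up#down : ∀ u v → Disjoint (ups m u v) (downs m u v)
  up#down (suc u) (suc v) (∈ups , ∈downs) with ∈-map⁻ up ∈ups | ∈-map⁻ down ∈downs
  ... | _ , _ , refl | _ , _ , ()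

  stay∉ups : ∀ u v {w : Walk u v m} → stay w ∉ ups m u v
  stay∉ups (suc u) v ∈ups with ∈-map⁻ up ∈ups
  ... | _ , _ , ()

  stay∉downs : ∀ u v {w : Walk u v m} → stay w ∉ downs m u v
  stay∉downs u (suc v) ∈downs with ∈-map⁻ down ∈downs
  ... | _ , _ , ()

  stay#rest : ∀ u v → Disjoint (map stay (walks m u v)) (ups m u v ++ downs m u v)
  stay#rest u v (∈stays , ∈rest) with ∈-map⁻ stay ∈stays | ∈-++⁻ (ups m u v) ∈rest
  ... | _ , _ , refl | inj₁ ∈ups   = stay∉ups u v ∈ups
  ... | _ , _ , refl | inj₂ ∈downs = stay∉downs u v ∈downs
ups-unique m zero v = []
ups-unique m (suc u) v = Unique.map⁺ (λ { refl → refl }) (walks-unique m u (suc v))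
downs-unique m u zero = []
downs-unique m u (suc v) = Unique.map⁺ (λ { refl → refl }) (walks-unique m (suc u) v)

-- Duplicate-free lists and the pigeonhole principle

private variable
  a ℓ : Level
  X : Set a

AllPairs-lookup : {R : Rel X ℓ} {xs : List X} → AllPairs R xs →
                  ∀ {i j} → i Fin.< j → R (lookup xs i) (lookup xs j)
AllPairs-lookup {xs = _ ∷ xs} (px ∷ _) {zero}  {suc j} _         = All.lookup px (∈-lookup j)
AllPairs-lookup               (_ ∷ ps) {suc i} {suc j} (s<s i<j) = AllPairs-lookup ps i<j

Unique-lookup-injective : {xs : List X} → Unique xs → ∀ {i j} → lookup xs i ≡ lookup xs j → i ≡ j
Unique-lookup-injective u {i} {j} eq with Fin.<-cmp i j
... | tri< i<j _ _ = ⊥-elim (AllPairs-lookup u i<j eq)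
... | tri≈ _ i≡j _ = i≡j
... | tri> _ _ j<i = ⊥-elim (AllPairs-lookup u j<i (sym eq))

-- Pigeonhole: each entry of `xs` is sent to its position in `ys`. A position determines its entry,
-- and `xs` has no repetition, so this map of indices is injective.
Unique-length-⊆ : {xs ys : List X} → Unique xs → xs ⊆ ys → length xs ≤ length ys
Unique-length-⊆ {xs = xs} u xs⊆ys = Fin.injective⇒≤ {f = λ i → Any.index (xs⊆ys (∈-lookup i))}
  λ eq → Unique-lookup-injective u (index-injective (setoid _) (xs⊆ys (∈-lookup _)) (xs⊆ys (∈-lookup _)) eq)

AllPairs-++-cross : {R : Rel X ℓ} (xs : List X) {ys : List X} → AllPairs R (xs ++ ys) →
                    ∀ {p q} → p ∈ xs → q ∈ ys → R p q
AllPairs-++-cross (x ∷ xs) (px ∷ _) (here refl) q∈ys = All.lookup px (∈-++⁺ʳ xs q∈ys)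
AllPairs-++-cross (x ∷ xs) (_ ∷ ps) (there p∈xs) q∈ys = AllPairs-++-cross xs ps p∈xs q∈ys

-- Top-k answers over an arbitrary total order

module _ {c ℓ₁ ℓ₂ : Level} (O : StrictTotalOrder c ℓ₁ ℓ₂) where

  open StrictTotalOrder O using () renaming (_<_ to _≺_)
  open Array

  -- Sorting by `entry` gives a weak order. Equal entries would mean equal positions, which
  -- uniqueness excludes, so the order is strict.
  ascending : {P : Set} (A : Array O P) {xs : List P} → Unique xs →
              ∃[ ys ] (ys ↭ xs × AllPairs (λ p q → entry A p ≺ entry A q) ys)
  ascending {P} A {xs} u = sort xs , sort-↭ xs ,
    AllPairs.zipWith strict
      ( Sorted⇒AllPairs totalOrder (sort-↗ xs)
      , Permutation.Unique-resp-↭ (setoid P) (↭⇒↭ₛ (↭-sym (sort-↭ xs))) u)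
    where
    byEntry : DecTotalOrder _ _ _
    byEntry = On.decTotalOrder (StrictTotalOrderProperties.decTotalOrder O) (entry A)
    open DecTotalOrder byEntry using (totalOrder) renaming (_≤_ to _≼_)
    open Sort byEntry
    strict : ∀ {p q} → p ≼ q × p ≢ q → entry A p ≺ entry A q
    strict (inj₁ p<q , _)   = p<q
    strict (inj₂ p≈q , p≢q) = ⊥-elim (p≢q (distinct A p≈q))

  -- `IsTopK` uses the entries only through comparisons that it asserts, so an order-preserving
  -- change of entries keeps every correct answer.
  isTopK-monotone : {P : Set} {A A′ : Array O P} →
    (∀ {p q} → entry A p ≺ entry A q → entry A′ p ≺ entry A′ q) →
    ∀ {κ k range xs} → IsTopK O κ k A range xs → IsTopK O κ k A′ range xs
  isTopK-monotone {P} {A} {A′} mono {κ} top = record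
    { unique = unique; within = within; size = size
    ; largest = λ p∈ q∈ q∉ → mono (largest p∈ q∈ q∉)
    ; inOrder = ordered κ inOrder
    }
    where
    open IsTopK top
    ordered : ∀ κ {xs} → InOrder O κ A xs → InOrder O κ A′ xs
    ordered sorted   = AllPairs.map mono
    ordered unsorted = λ _ → lift _

  -- The positions of range outside xs have distinct ranks below ρ p.
  topK-rank : {P : Set} → DecidableEquality P → (A : Array O P) (ρ : P → ℕ) →
    (∀ {p q} → ρ p ≡ ρ q → p ≡ q) → (∀ {p q} → entry A p ≺ entry A q → ρ p < ρ q) →
    ∀ {κ k range xs} → Unique range → IsTopK O κ k A range xs →
    ∀ {p} → p ∈ xs → length range ≤ length xs + ρ p
  topK-rank _≟_ A ρ ρ-injective ρ-monotone {range = range} {xs} u top {p} p∈xs = begin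
    length range                      ≤⟨ Unique-length-⊆ u split ⟩
    length (xs ++ rest)               ≡⟨ length-++ xs ⟩
    length xs + length rest           ≡⟨ cong (length xs +_) (length-map ρ rest) ⟨
    length xs + length (map ρ rest)   ≤⟨ +-monoʳ-≤ (length xs) (Unique-length-⊆ rest-unique below) ⟩
    length xs + length (upTo (ρ p))   ≡⟨ cong (length xs +_) (length-upTo (ρ p)) ⟩
    length xs + ρ p                   ∎
    where
    open ≤-Reasoning
    open DecMembership _≟_ using (_∈?_)
    new? = λ q → ¬? (q ∈? xs)
    rest = filter new? range
    rest-unique : Unique (map ρ rest)
    rest-unique = Unique.map⁺ ρ-injective (Unique.filter⁺ new? u)
    split : range ⊆ xs ++ rest
    split {q} q∈range with q ∈? xs
    ... | yes q∈xs = ∈-++⁺ˡ q∈xs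
    ... | no  q∉xs = ∈-++⁺ʳ xs (∈-filter⁺ new? q∈range q∉xs)
    below : map ρ rest ⊆ upTo (ρ p)
    below i∈ with ∈-map⁻ ρ i∈
    ... | q , q∈rest , refl with ∈-filter⁻ new? q∈rest
    ...   | q∈range , q∉xs = ∈-upTo⁺ (ρ-monotone (IsTopK.largest top p∈xs q∈range q∉xs))

-- Sorting in the flipped order puts the largest entries first. Having some answer turns "no common
-- answer" into "different answer sets".
topK-exists : ∀ {c ℓ₁ ℓ₂} (O : StrictTotalOrder c ℓ₁ ℓ₂) {P : Set} (A : Array O P) k {range} →
              Unique range → ∃[ xs ] IsTopK O unsorted k A range xs
topK-exists O {P} A k {range} u with ascending (Flip.strictTotalOrder O) flipped u
  where
  flipped : Array (Flip.strictTotalOrder O) P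
  flipped = record { entry = Array.entry A ; distinct = Array.distinct A }
... | ys , ys↭range , desc = take k ys , record
  { unique  = Unique.take⁺ k (Permutation.Unique-resp-↭ (setoid P) (↭⇒↭ₛ (↭-sym ys↭range)) u)
  ; within  = λ p∈ → ∈-resp-↭ ys↭range (subst (_ ∈_) (take++drop≡id k ys) (∈-++⁺ˡ p∈))
  ; size    = trans (length-take k ys) (cong (k ⊓_) (↭-length ys↭range))
  ; largest = larger
  ; inOrder = lift _
  }
  where
  open StrictTotalOrder O using () renaming (_<_ to _≺_)
  larger : ∀ {p q} → p ∈ take k ys → q ∈ range → q ∉ take k ys → Array.entry A q ≺ Array.entry A p
  larger p∈ q∈ q∉ with ∈-++⁻ (take k ys) (subst (_ ∈_) (sym (take++drop≡id k ys)) (∈-resp-↭ (↭-sym ys↭range) q∈))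
  ... | inj₁ q∈take = ⊥-elim (q∉ q∈take)
  ... | inj₂ q∈drop = AllPairs-++-cross (take k ys) (subst (AllPairs _) (sym (take++drop≡id k ys)) desc) p∈ q∈drop

-- Sizes of query regions

length-cartesianProduct : {X Y : Set} (xs : List X) (ys : List Y) →
                          length (cartesianProduct xs ys) ≡ length xs * length ys
length-cartesianProduct []       ys = refl
length-cartesianProduct (x ∷ xs) ys =
  trans (length-++ (map (x ,_) ys)) (cong₂ _+_ (length-map (x ,_) ys) (length-cartesianProduct xs ys))

length-prefix-≥ : ∀ {n} (i : Fin n) → suc (toℕ i) ≤ length (prefix i)
length-prefix-≥ {n} i = begin
  suc (toℕ i)                    ≡⟨ length-upTo (suc (toℕ i)) ⟨
  length (upTo (suc (toℕ i)))    ≤⟨ Unique-length-⊆ (Unique.upTo⁺ (suc (toℕ i))) present ⟩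
  length (map toℕ (prefix i))    ≡⟨ length-map toℕ (prefix i) ⟩
  length (prefix i)              ∎
  where
  open ≤-Reasoning
  present : upTo (suc (toℕ i)) ⊆ map toℕ (prefix i)
  present {l} l∈ = subst (_∈ _) (Fin.toℕ-fromℕ< l<n)
    (∈-map⁺ toℕ (∈-filter⁺ (Fin._≤? i) (∈-allFin _) (subst (_≤ toℕ i) (sym (Fin.toℕ-fromℕ< l<n)) l≤i)))
    where
    l≤i : l ≤ toℕ i
    l≤i = ≤-pred (∈-upTo⁻ l∈)
    l<n : l < n
    l<n = ≤-<-trans l≤i (Fin.toℕ<n i)

bothRows : ∀ {n} → Fin n → ThreeSidedQuery n
bothRows b = record { r = 0F ; s = 1F ; r≤s = z≤n ; b = b }

region-unique : ∀ {n} (q : ThreeSidedQuery n) → Unique (region q)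
region-unique {n} q = Unique.cartesianProduct⁺
  (Unique.filter⁺ (λ x → (r Fin.≤? x) ×-dec (x Fin.≤? s)) (Unique.allFin⁺ 2))
  (Unique.filter⁺ (Fin._≤? b) (Unique.allFin⁺ n))
  where open ThreeSidedQuery q

length-bothRows-≥ : ∀ {n} (b : Fin n) → 2 * suc (toℕ b) ≤ length (region (bothRows b))
length-bothRows-≥ b = ≤-trans (*-monoʳ-≤ 2 (length-prefix-≥ b))
  (≤-reflexive (sym (length-cartesianProduct (0F ∷ 1F ∷ []) (prefix b))))

∈-bothRows : ∀ {n} (b : Fin n) {r j} → (r , j) ∈ region (bothRows b) → toℕ j ≤ toℕ b
∈-bothRows {n} b p∈ =
  proj₂ (∈-filter⁻ (Fin._≤? b) {xs = allFin n} (proj₂ (∈-cartesianProduct⁻ (0F ∷ 1F ∷ []) (prefix b) p∈)))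

-- Each row contributes at most an interval of integers, whose length is the truncated difference.
length-≤-between : ∀ {n} (a : Fin 2 → ℕ) b {xs : List (Fin 2 × Fin n)} → Unique xs →
                 (∀ {r j} → (r , j) ∈ xs → a r ≤ toℕ j × toℕ j < b) →
                 length xs ≤ (b ∸ a 0F) + (b ∸ a 1F)
length-≤-between {n} a b {xs} u bounds = begin
  length xs                                 ≡⟨ length-map position xs ⟨
  length (map position xs)                  ≤⟨ Unique-length-⊆ (Unique.map⁺ position-injective u) covered ⟩
  length (columns 0F ++ columns 1F)         ≡⟨ length-++ (columns 0F) ⟩
  length (columns 0F) + length (columns 1F) ≡⟨ cong₂ _+_ (length-columns 0F) (length-columns 1F) ⟩
  (b ∸ a 0F) + (b ∸ a 1F)                   ∎
  where
  open ≤-Reasoning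
  position : Fin 2 × Fin n → Fin 2 × ℕ
  position (r , j) = r , toℕ j
  position-injective : ∀ {p q} → position p ≡ position q → p ≡ q
  position-injective eq = cong₂ _,_ (cong proj₁ eq) (Fin.toℕ-injective (cong proj₂ eq))
  columns : Fin 2 → List (Fin 2 × ℕ)
  columns r = map (r ,_) (applyUpTo (a r +_) (b ∸ a r))
  length-columns : ∀ r → length (columns r) ≡ b ∸ a r
  length-columns r = trans (length-map (r ,_) (applyUpTo (a r +_) (b ∸ a r))) (length-applyUpTo (a r +_) (b ∸ a r))
  ∈-columns : ∀ {r j} → a r ≤ j → j < b → (r , j) ∈ columns r
  ∈-columns {r} {j} a≤j j<b = ∈-map⁺ (r ,_) (subst (_∈ _) (m+[n∸m]≡n a≤j)
                                (∈-applyUpTo⁺ (a r +_) (∸-monoˡ-< j<b a≤j)))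
  covered : map position xs ⊆ columns 0F ++ columns 1F
  covered p∈ with ∈-map⁻ position p∈
  ... | (0F , j) , p∈xs , refl = ∈-++⁺ˡ (uncurry ∈-columns (bounds p∈xs))
  ... | (1F , j) , p∈xs , refl = ∈-++⁺ʳ (columns 0F) (uncurry ∈-columns (bounds p∈xs))

-- The arrays built from walks

height-start : ∀ {m} (w : Walk 1 1 m) r → height w 0 r ≡ 1
height-start w 0F = refl
height-start w 1F = refl

late-middle : ∀ {m} (w : Walk 1 1 m) r t {j} → t * 2 ≤ rank w r j → t + height w t r ≤ suc j
late-middle w r t {j} le = ≤-trans (late w r t le)
  (≤-reflexive (trans (cong (j +_) (height-start w r)) (+-comm j 1)))

module _ {c ℓ₁ ℓ₂ : Level} (O : StrictTotalOrder c ℓ₁ ℓ₂) where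

  open StrictTotalOrder O using (Carrier; _≈_; irrefl; asym; module Eq) renaming (_<_ to _≺_)
  open Array

  -- An arbitrary order offers no concrete elements, so the `2 n` values of the family are borrowed
  -- from a given array.
  ascendingEntries : ∀ {n} → Array₂ O n →
    Σ[ value ∈ (Fin (n * 2) → Carrier) ] (∀ {i j} → i Fin.< j → value i ≺ value j)
  ascendingEntries {n} A with ascending O A (Unique.cartesianProduct⁺ (Unique.allFin⁺ 2) (Unique.allFin⁺ n))
  ... | ys , ys↭ , ys↑ = (λ i → entry A (lookup ys (cast size i)))
                       , λ {i} {j} i<j → AllPairs-lookup ys↑
                          (subst₂ _<_ (sym (Fin.toℕ-cast size i)) (sym (Fin.toℕ-cast size j)) i<j)
    where
    size : n * 2 ≡ length ys
    size = sym (begin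
      length ys                                        ≡⟨ ↭-length ys↭ ⟩
      length (cartesianProduct (allFin 2) (allFin n))  ≡⟨ length-cartesianProduct (allFin 2) (allFin n) ⟩
      2 * length (allFin n)                            ≡⟨ cong (2 *_) (length-tabulate {n = n} id) ⟩
      2 * n                                            ≡⟨ *-comm 2 n ⟩
      n * 2                                            ∎)
      where open ≡-Reasoning

  module Family {n m : ℕ} (m≤n : m ≤ n) (value : Fin (n * 2) → Carrier)
                (value-increasing : ∀ {i j} → i Fin.< j → value i ≺ value j) where

    position-rank : Walk 1 1 m → Fin 2 × Fin n → ℕ
    position-rank w (r , j) = rank w r (toℕ j)

    position-rank-injective : ∀ w {p q} → position-rank w p ≡ position-rank w q → p ≡ q
    position-rank-injective w eq with rank-injective w eq
    ... | r≡s , i≡j = cong₂ _,_ r≡s (Fin.toℕ-injective i≡j)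

    -- By time `n` the walk is back in the middle, as `m ≤ n`. A rank of at least `2 n` would
    -- therefore force a column index of at least `n`.
    position-rank-< : ∀ w p → position-rank w p < n * 2
    position-rank-< w (r , j) = ≰⇒> λ le → <⇒≱ (Fin.toℕ<n j) (≤-pred
      (subst (_≤ suc (toℕ j)) (trans (cong (n +_) (height-end w r m≤n)) (+-comm n 1)) (late-middle w r n le)))

    slot : Walk 1 1 m → Fin 2 × Fin n → Fin (n * 2)
    slot w p = fromℕ< (position-rank-< w p)

    toℕ-slot : ∀ w p → toℕ (slot w p) ≡ position-rank w p
    toℕ-slot w p = Fin.toℕ-fromℕ< (position-rank-< w p)

    value-injective : ∀ {i j} → value i ≈ value j → i ≡ j
    value-injective {i} {j} eq with Fin.<-cmp i j
    ... | tri< i<j _ _ = ⊥-elim (irrefl eq (value-increasing i<j))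
    ... | tri≈ _ i≡j _ = i≡j
    ... | tri> _ _ j<i = ⊥-elim (irrefl (Eq.sym eq) (value-increasing j<i))

    array : Walk 1 1 m → Array₂ O n
    array w .entry p     = value (slot w p)
    array w .distinct {p} {q} eq = position-rank-injective w
      (trans (sym (toℕ-slot w p)) (trans (cong toℕ (value-injective eq)) (toℕ-slot w q)))

    entry-increasing : ∀ w {p q} → position-rank w p < position-rank w q → entry (array w) p ≺ entry (array w) q
    entry-increasing w {p} {q} lt = value-increasing (subst₂ _<_ (sym (toℕ-slot w p)) (sym (toℕ-slot w q)) lt)

    entry-reflects-< : ∀ w {p q} → entry (array w) p ≺ entry (array w) q → position-rank w p < position-rank w q
    entry-reflects-< w {p} {q} lt with <-cmp (position-rank w p) (position-rank w q)
    ... | tri< p<q _ _ = p<q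
    ... | tri≈ _ eq _  = ⊥-elim (irrefl (Eq.reflexive (cong (entry (array w)) (position-rank-injective w {p} {q} eq))) lt)
    ... | tri> _ _ q<p = ⊥-elim (asym lt (entry-increasing w q<p))

    -- Rows increase in every array of the family, so the order within a row is that of the columns,
    -- whatever the walk.
    sameRows : ∀ w w′ r κ k → SameAnswers O κ k prefix (row O r (array w)) (row O r (array w′))
    sameRows w w′ r κ k q xs = mk⇔ (isTopK-monotone O (mono w w′)) (isTopK-monotone O (mono w′ w))
      where
      mono : ∀ w w′ {i j} → entry (array w) (r , i) ≺ entry (array w) (r , j) →
             entry (array w′) (r , i) ≺ entry (array w′) (r , j)
      mono w w′ lt = entry-increasing w′ (rank-increasing w′ r (rank-reflects-< w r (entry-reflects-< w lt)))

    module _ {h t : ℕ} (1≤h : 1 ≤ h) (h+t<n : h + t < n) where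

      -- Indices start at 0: this query covers the first `h + t + 1` columns and belongs to time
      -- `t + 1`.
      private b = fromℕ< h+t<n

      -- The region has at least `2 (h + t + 1)` positions and the answer at most `2 h`, so
      -- `topK-rank` gives every reported position a rank of at least `2 (t + 1)`. Then
      -- `late-middle` bounds its column.
      topK-late : ∀ w {κ xs} → IsTopK O κ (h * 2) (array w) (region (bothRows b)) xs →
                  ∀ {r j} → (r , j) ∈ xs → t + height w (suc t) r ≤ toℕ j
      topK-late w {xs = xs} top {r} {j} p∈ = ≤-pred (late-middle w r (suc t) (+-cancelˡ-≤ (h * 2) _ _ (begin
        h * 2 + suc t * 2               ≡⟨ rearrange h t ⟩
        2 * suc (h + t)                 ≡⟨ cong (λ x → 2 * suc x) (Fin.toℕ-fromℕ< h+t<n) ⟨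
        2 * suc (toℕ b)                 ≤⟨ length-bothRows-≥ b ⟩
        length (region (bothRows b))    ≤⟨ crowded ⟩
        length xs + rank w r (toℕ j)    ≤⟨ +-monoˡ-≤ _ (≤-trans (≤-reflexive (IsTopK.size top)) (m⊓n≤m (h * 2) _)) ⟩
        h * 2 + rank w r (toℕ j)        ∎)))
        where
        open ≤-Reasoning
        crowded : length (region (bothRows b)) ≤ length xs + rank w r (toℕ j)
        crowded = topK-rank O (≡-dec Fin._≟_ Fin._≟_) (array w) (position-rank w) (position-rank-injective w)
                    (entry-reflects-< w) (region-unique (bothRows b)) top p∈
        rearrange : ∀ h t → h * 2 + suc t * 2 ≡ 2 * suc (h + t)
        rearrange = solve-∀

      -- A common answer avoids the 2 (t + 1) lowest ranks of either array, and fewer than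
      -- k positions of the region do.
      noCommonAnswer : ∀ w w′ {κ xs} → height w (suc t) 0F < height w′ (suc t) 0F →
        IsTopK O κ (h * 2) (array w) (region (bothRows b)) xs →
        IsTopK O κ (h * 2) (array w′) (region (bothRows b)) xs → ⊥
      noCommonAnswer w w′ {xs = xs} lt top top′ = <⇒≱ (n<1+n (2 + h * 2)) (begin
        3 + h * 2                                         ≡⟨ +-comm 3 (h * 2) ⟩
        h * 2 + 3                                         ≤⟨ +-mono-≤ few wide ⟩
        ((suc h ∸ H₀) + (suc h ∸ H₁)) + (H₀ + H₁)         ≡⟨ rearrange (suc h ∸ H₀) (suc h ∸ H₁) H₀ H₁ ⟩
        ((suc h ∸ H₀) + H₀) + ((suc h ∸ H₁) + H₁)         ≡⟨ cong₂ _+_ (m∸n+n≡m (small H₀≤2)) (m∸n+n≡m (small H₁≤2)) ⟩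
        suc h + suc h                                     ≡⟨ double h ⟩
        2 + h * 2                                         ∎)
        where
        open ≤-Reasoning
        -- The stronger bound is taken in each row: `w′` is higher in row 0, hence `w` is higher in
        -- row 1, and the sum exceeds 2.
        H₀ = height w′ (suc t) 0F
        H₁ = height w (suc t) 1F
        wide : 3 ≤ H₀ + H₁
        wide = ≤-trans (≤-reflexive (cong suc (sym (height-sum w (suc t))))) (+-monoˡ-≤ H₁ lt)
        H₀≤2 : H₀ ≤ 2
        H₀≤2 = ≤-trans (m≤m+n _ _) (≤-reflexive (height-sum w′ (suc t)))
        H₁≤2 : H₁ ≤ 2
        H₁≤2 = ≤-trans (m≤n+m _ _) (≤-reflexive (height-sum w (suc t)))
        -- With `1 ≤ h` the heights do not exceed `suc h`, so the truncated subtractions from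
        -- `suc h` are exact.
        small : ∀ {x} → x ≤ 2 → x ≤ suc h
        small le = ≤-trans le (s≤s 1≤h)
        rearrange : ∀ a b c d → (a + b) + (c + d) ≡ (a + c) + (b + d)
        rearrange = solve-∀
        double : ∀ h → suc h + suc h ≡ 2 + h * 2
        double = solve-∀
        first : Fin 2 → ℕ
        first 0F = t + H₀
        first 1F = t + H₁
        bounds : ∀ {r j} → (r , j) ∈ xs → first r ≤ toℕ j × toℕ j < t + suc h
        bounds {r} {j} p∈ = from r p∈ , (begin
          suc (toℕ j)     ≤⟨ s≤s (∈-bothRows b (IsTopK.within top p∈)) ⟩
          suc (toℕ b)     ≡⟨ cong suc (Fin.toℕ-fromℕ< h+t<n) ⟩
          suc (h + t)     ≡⟨ +-comm (suc h) t ⟩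
          t + suc h       ∎)
          where
          from : ∀ r → (r , j) ∈ xs → first r ≤ toℕ j
          from 0F = topK-late w′ top′
          from 1F = topK-late w top
        -- The region is large enough for the answer to have the full size `k = h * 2`.
        full : h * 2 ≤ length xs
        full = ≤-trans (⊓-glb ≤-refl (begin
          h * 2                           ≤⟨ *-monoˡ-≤ 2 (m≤n⇒m≤1+n (m≤m+n h t)) ⟩
          suc (h + t) * 2                 ≡⟨ *-comm (suc (h + t)) 2 ⟩
          2 * suc (h + t)                 ≡⟨ cong (λ x → 2 * suc x) (Fin.toℕ-fromℕ< h+t<n) ⟨
          2 * suc (toℕ b)                 ≤⟨ length-bothRows-≥ b ⟩
          length (region (bothRows b))    ∎)) (≤-reflexive (sym (IsTopK.size top)))
        few : h * 2 ≤ (suc h ∸ H₀) + (suc h ∸ H₁)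
        few = begin
          h * 2                                          ≤⟨ full ⟩
          length xs                                      ≤⟨ length-≤-between first (t + suc h) (IsTopK.unique top) bounds ⟩
          (t + suc h ∸ (t + H₀)) + (t + suc h ∸ (t + H₁)) ≡⟨ cong₂ _+_ ([m+n]∸[m+o]≡n∸o t (suc h) H₀) ([m+n]∸[m+o]≡n∸o t (suc h) H₁) ⟩
          (suc h ∸ H₀) + (suc h ∸ H₁)                    ∎

    -- The separating time `t + 1` is at most `m = n - h`, which is what keeps the last queried
    -- column `h + t` inside the array.
    distinguish : ∀ {h} → 1 ≤ h → h + m ≡ n → ∀ w w′ → w ≢ w′ →
      ∃[ q ] (∀ {κ xs} → IsTopK O κ (h * 2) (array w) (region q) xs →
        IsTopK O κ (h * 2) (array w′) (region q) xs → ⊥)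
    distinguish {h} 1≤h refl w w′ w≢w′ with separate w w′
    ... | inj₁ w≡w′ = ⊥-elim (w≢w′ w≡w′)
    -- Time 0 cannot separate, since both walks start in the middle.
    ... | inj₂ (zero , _ , ne) = ⊥-elim (ne refl)
    ... | inj₂ (suc t , t<m , ne) = bothRows (fromℕ< h+t<n) , clash
      where
      h+t<n : h + t < h + m
      h+t<n = +-monoʳ-< h t<m
      clash : ∀ {κ xs} → IsTopK O κ (h * 2) (array w) _ xs → IsTopK O κ (h * 2) (array w′) _ xs → ⊥
      clash top top′ with <-cmp (height w (suc t) 0F) (height w′ (suc t) 0F)
      ... | tri< lt _ _ = noCommonAnswer 1≤h h+t<n w w′ lt top top′
      ... | tri≈ _ eq _ = ne eq
      ... | tri> _ _ gt = noCommonAnswer 1≤h h+t<n w′ w gt top′ top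

-- Estimates for powers of 1 + √2 and their logarithms

_≤√?_ : ∀ x c → Dec (x ≤√ c)
(a +√2· b) ≤√? c = (a ≤? c) ×-dec (2 * (b * b) ≤? (c ∸ a) * (c ∸ a))

-- Since √2 ≤ 2.
≤√-intro : ∀ {a b c} → a + 2 * b ≤ c → (a +√2· b) ≤√ c
≤√-intro {a} {b} {c} le = ≤-trans (m≤m+n a _) le , (begin
  2 * (b * b)          ≤⟨ *-monoʳ-≤ 2 (*-monoʳ-≤ b (m≤n*m b 2)) ⟩
  2 * (b * (2 * b))    ≡⟨ *-assoc 2 b (2 * b) ⟨
  (2 * b) * (2 * b)    ≤⟨ *-mono-≤ 2b≤c∸a 2b≤c∸a ⟩
  (c ∸ a) * (c ∸ a)    ∎)
  where
  open ≤-Reasoning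
  2b≤c∸a : 2 * b ≤ c ∸ a
  2b≤c∸a = m+n≤o⇒m≤o∸n (2 * b) (≤-trans (≤-reflexive (+-comm (2 * b) a)) le)

irr≤rat : ∀ m → let open ℕ[√2] (1+√2 ^√ m) in irr ≤ rat
irr≤rat zero    = z≤n
irr≤rat (suc m) = begin
  1 * irr + 1 * rat    ≡⟨ +-comm (1 * irr) (1 * rat) ⟩
  1 * rat + 1 * irr    ≤⟨ +-monoʳ-≤ (1 * rat) (m≤n*m (1 * irr) 2) ⟩
  1 * rat + 2 * (1 * irr) ∎
  where
  open ≤-Reasoning
  open ℕ[√2] (1+√2 ^√ m)

-- `rat` counts the walks, and `irr ≤ rat` with √2 ≤ 2 bounds the power by `3 * rat`. Rounding 3 up
-- to 4 makes the loss a whole number of bits.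
1+√2-^√-≤√ : ∀ m {c} → length (walks m 1 1) * 4 ≤ c → (1+√2 ^√ m) ≤√ c
1+√2-^√-≤√ m {c} le = ≤√-intro {rat} {irr} (begin
  rat + 2 * irr                ≤⟨ +-monoʳ-≤ rat (*-monoʳ-≤ 2 (irr≤rat m)) ⟩
  rat + 2 * rat                ≤⟨ m≤n+m _ rat ⟩
  4 * rat                      ≡⟨ *-comm 4 rat ⟩
  rat * 4                      ≡⟨ cong (_* 4) (proj₁ (length-walks m)) ⟨
  length (walks m 1 1) * 4     ≤⟨ le ⟩
  c                            ∎)
  where
  open ≤-Reasoning
  open ℕ[√2] (1+√2 ^√ m)

least : ∀ {p} {P : ℕ → Set p} → Decidable P → ∀ n → P n → ∃[ m ] (P m × ∀ j → P j → m ≤ j)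
least P? n pn with P? 0
... | yes p0 = 0 , p0 , λ _ _ → z≤n
least P? zero    pn | no ¬p0 = ⊥-elim (¬p0 pn)
least P? (suc n) pn | no ¬p0 with least (P? ∘ suc) n pn
... | m , pm , minimal = suc m , pm , λ where
  zero    p0 → ⊥-elim (¬p0 p0)
  (suc j) pj → s≤s (minimal j pj)

n<2^n : ∀ n → n < 2 ^ n
n<2^n zero    = s≤s z≤n
n<2^n (suc n) = +-mono-≤ (≤-trans (s≤s z≤n) (n<2^n n)) (≤-trans (n<2^n n) (m≤m+n _ 0))

-- Since `c < 2 ^ c`, four times the number of walks is itself a sufficient exponent and bounds the
-- search for the least one.
⌈lg⌉-1+√2-^√ : ∀ m → ∃[ t ] t ≡⌈lg (1+√2 ^√ m) ⌉
⌈lg⌉-1+√2-^√ m = least (λ c → (1+√2 ^√ m) ≤√? (2 ^ c)) bound (1+√2-^√-≤√ m (<⇒≤ (n<2^n bound)))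
  where bound = length (walks m 1 1) * 4

-- Counting bit strings

-- Bijective base-2 numeration.
code : Bits → ℕ
code []          = 0
code (false ∷ x) = suc (code x * 2)
code (true ∷ x)  = suc (suc (code x * 2))

code-injective : ∀ {x y} → code x ≡ code y → x ≡ y
code-injective {[]}        {[]}        eq = refl
code-injective {[]}        {false ∷ _} ()
code-injective {[]}        {true ∷ _}  ()
code-injective {false ∷ _} {[]}        ()
code-injective {true ∷ _}  {[]}        ()
code-injective {false ∷ x} {false ∷ y} eq =
  cong (false ∷_) (code-injective (*-cancelʳ-≡ (code x) (code y) 2 (suc-injective eq)))
code-injective {false ∷ x} {true ∷ y}  eq = ⊥-elim (double≢suc-double (code x) (code y) (suc-injective eq))
code-injective {true ∷ x}  {false ∷ y} eq = ⊥-elim (double≢suc-double (code y) (code x) (sym (suc-injective eq)))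
code-injective {true ∷ x}  {true ∷ y}  eq =
  cong (true ∷_) (code-injective (*-cancelʳ-≡ (code x) (code y) 2 (suc-injective (suc-injective eq))))

-- Adding 2 makes the induction close: a further digit at most doubles `2 + code x`.
code-bound : ∀ x → 2 + code x ≤ 2 ^ suc (length x)
code-bound []          = ≤-refl
code-bound (false ∷ x) = ≤-trans (n≤1+n _)
  (subst ((2 + code x) * 2 ≤_) (*-comm (2 ^ suc (length x)) 2) (*-monoˡ-≤ 2 (code-bound x)))
code-bound (true ∷ x)  = subst ((2 + code x) * 2 ≤_) (*-comm (2 ^ suc (length x)) 2) (*-monoˡ-≤ 2 (code-bound x))

-- `code` sends the strings of all lengths below `l` into `Fin (2 ^ l)` without collisions, so no
-- sum over lengths is needed.
injective-Bits-≤ : ∀ {M l} (f : Fin M → Bits) → (∀ {i j} → f i ≡ f j → i ≡ j) →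
                   (∀ i → length (f i) < l) → M ≤ 2 ^ l
injective-Bits-≤ {l = l} f f-injective short = Fin.injective⇒≤ {f = λ i → fromℕ< (below i)}
  λ {i} {j} eq → f-injective (code-injective (Fin.fromℕ<-injective (code (f i)) (code (f j)) (below i) (below j) eq))
  where
  below : ∀ i → code (f i) < 2 ^ l
  below i = ≤-trans (n≤1+n _) (≤-trans (code-bound (f i)) (^-monoʳ-≤ 2 (short i)))

-- Both bounds from a family with equal rows and no common answers

module _ {c ℓ₁ ℓ₂ : Level} (O : StrictTotalOrder c ℓ₁ ℓ₂) {k n m : ℕ} {M : ℕ}
         (large : ∀ {c} → M * 4 ≤ c → (1+√2 ^√ m) ≤√ c) (family : Fin M → Array₂ O n)
         (family-sameRows : ∀ i j r κ → SameAnswers O κ k prefix (row O r (family i)) (row O r (family j)))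
         (family-distinguish : ∀ i j → i ≢ j → ∃[ q ] (∀ {κ xs} →
           IsTopK O κ k (family i) (region q) xs → IsTopK O κ k (family j) (region q) xs → ⊥))
         where

  familyBound : FamilyBound O k n m 3
  -- The factor 4 in `large` is covered by `2 ^ 3`, the error shared with the encoding bound.
  familyBound = M , family , family-sameRows , different , large (*-monoʳ-≤ M (s≤s (s≤s (s≤s (s≤s z≤n)))))
    where
    different : ∀ i j → ¬ i ≡ j → ¬ SameAnswers O unsorted k region (family i) (family j)
    different i j i≢j same with family-distinguish i j i≢j
    ... | q , clash with topK-exists O (family i) k (region-unique q)
    ...   | xs , top = clash top (Equivalence.to (same q xs) top)

  encodingBound : Array₂ O n → EncodingBound O k n m 3
  encodingBound A₀ = t , t-ceil , worst
    where
    t = proj₁ (⌈lg⌉-1+√2-^√ m)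
    t-ceil = proj₂ (⌈lg⌉-1+√2-^√ m)
    module _ κ (E₁ E₂ : RowEncoding O κ k n) (X : ThreeSidedEncoding O E₁ E₂) where
      open RowEncoding
      open ThreeSidedEncoding X
      -- Equal row answers give equal row encodings. Equal additional bits would then decode to one
      -- list that is correct for both arrays, which the distinguishing query forbids.
      additional-injective : ∀ {i j} → additional (family i) ≡ additional (family j) → i ≡ j
      additional-injective {i} {j} eq with i Fin.≟ j
      ... | yes i≡j = i≡j
      ... | no  i≢j with family-distinguish i j i≢j
      ...   | q , clash = ⊥-elim (clash (correct₂ (family i) q)
        (subst (IsTopK O unsorted k (family j) (region q)) (sym sameAnswer) (correct₂ (family j) q)))
        where
        sameAnswer : decode₂ (encode E₁ (row O 0F (family i))) (encode E₂ (row O 1F (family i))) (additional (family i)) q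
                   ≡ decode₂ (encode E₁ (row O 0F (family j))) (encode E₂ (row O 1F (family j))) (additional (family j)) q
        sameAnswer rewrite onlyAnswers E₁ _ _ (family-sameRows i j 0F κ)
                         | onlyAnswers E₂ _ _ (family-sameRows i j 1F κ) | eq = refl

      -- If every member of the family fails, its additional string is shorter than `l = t - 3`, so
      -- `M ≤ 2 ^ l`. Then `large` makes `l + 2 = t - 1` a sufficient exponent, against the
      -- minimality of `t`.
      worst : Σ[ A ∈ Array₂ O n ] t ≤ length (additional A) + 3
      worst with Fin.any? (λ i → t ≤? length (additional (family i)) + 3)
      ... | yes (i , le) = family i , le
      ... | no none with t in t-eq
      -- For `t` below 3 the error term alone suffices, and any array will do.
      ...   | 0 = A₀ , z≤n
      ...   | 1 = A₀ , ≤-trans (s≤s z≤n) (m≤n+m 3 _)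
      ...   | 2 = A₀ , ≤-trans (s≤s (s≤s z≤n)) (m≤n+m 3 _)
      ...   | suc (suc (suc l)) = ⊥-elim (<⇒≱ {2 + l} {t} (≤-reflexive (sym t-eq)) (proj₂ t-ceil (2 + l) enough))
        where
        short : ∀ i → length (additional (family i)) < l
        short i = +-cancelʳ-< 3 _ l (<-≤-trans (≰⇒> (λ le → none (i , le))) (≤-reflexive (+-comm 3 l)))
        enough : lg (1+√2 ^√ m) ≤ (2 + l)
        enough = large (≤-trans (*-monoˡ-≤ 4 (injective-Bits-≤ (additional ∘ family) additional-injective short))
                   (≤-reflexive (quadruple (2 ^ l))))
          where
          quadruple : ∀ x → x * 4 ≡ 2 * (2 * x)
          quadruple = solve-∀

-- Conclusion for `k = h * 2`

module _ {c ℓ₁ ℓ₂ : Level} (O : StrictTotalOrder c ℓ₁ ℓ₂) {h m n : ℕ} (1≤h : 1 ≤ h) (h+m≡n : h + m ≡ n) where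

  bothBounds : Array₂ O n → EncodingBound O (h * 2) n m 3 × FamilyBound O (h * 2) n m 3
  bothBounds A with ascendingEntries O A
  ... | value , value-increasing =
      encodingBound O {m = m} (1+√2-^√-≤√ m) family sameRows different A
    , familyBound O {m = m} (1+√2-^√-≤√ m) family sameRows different
    where
    module F = Family O (≤-trans (m≤n+m m h) (≤-reflexive h+m≡n)) value value-increasing
    family : Fin (length (walks m 1 1)) → Array₂ O n
    family i = F.array (lookup (walks m 1 1) i)
    sameRows : ∀ i j r κ → SameAnswers O κ (h * 2) prefix (row O r (family i)) (row O r (family j))
    sameRows i j r κ = F.sameRows _ _ r κ (h * 2)
    different : ∀ i j → i ≢ j → ∃[ q ] (∀ {κ xs} →
      IsTopK O κ (h * 2) (family i) (region q) xs → IsTopK O κ (h * 2) (family j) (region q) xs → ⊥)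
    different i j i≢j = F.distinguish 1≤h h+m≡n _ _ (i≢j ∘ Unique-lookup-injective (walks-unique m 1 1))

theorem10 : ∀ {c ℓ₁ ℓ₂} →
    (Σ[ e ∈ (ℕ → ℕ) ] (LittleO e ×
    (∀ (O : StrictTotalOrder c ℓ₁ ℓ₂) (k n : ℕ) → 2 ≤ k → 2 ∣ k → k / 2 < n → Array₂ O n →
    EncodingBound O k n (n ∸ k / 2) (e n) × FamilyBound O k n (n ∸ k / 2) (e n))))
    × lg[1+√2]≈1·27
-- The constant 3 is o(n), as `q * 3 ≤ n` from `n = q * 3` on. The two numerical estimates are
-- decided by evaluating integer inequalities.
theorem10 = ((λ _ → 3) , (λ q → q * 3 , λ _ le → le) , bounds)
          , from-no ((1+√2 ^√ 200) ≤√? (2 ^ 253))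
          , from-yes ((1+√2 ^√ 40) ≤√? (2 ^ 51))
  where
  bounds : ∀ O k n → 2 ≤ k → 2 ∣ k → k / 2 < n → Array₂ O n →
           EncodingBound O k n (n ∸ k / 2) 3 × FamilyBound O k n (n ∸ k / 2) 3
  bounds O _ n 2≤k (divides h refl) k/2<n A rewrite m*n/n≡m h 2 {{_}} =
    bothBounds O 1≤h h+m≡n A
    where
    1≤h : 1 ≤ h
    1≤h = *-cancelʳ-≤ 1 h 2 2≤k
    h+m≡n : h + (n ∸ h) ≡ n
    h+m≡n = m+[n∸m]≡n (<⇒≤ k/2<n)
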